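{- Let $d$ be a positive integer. If $G$ is a bipartite, $d$-regular graph on $4n$ vertices (for some positive integer $n$), then $G$ is balanceable.
   Context: All graphs are simple and finite. A 2-coloring of the edges of $K_N$ is a function $\alpha:E(K_N)\to\{R,B\}$. It contains a balanced copy of a graph $G$ if $K_N$ has a (not necessarily induced) subgraph isomorphic to $G$ whose edge set is partitioned into $E_1,E_2$ with $\alpha(e)=R$ for $e\in E_1$, $\alpha(e)=B$ for $e\in E_2$, and $\big||E_1|-|E_2|\big|\le 1$. A graph $G$ is balanceable if there is an $N_0$ such that for every $N\ge N_0$ there exists an integer $m$ with $0\le m<\lfloor \frac12\binom N2\rfloor$ such that every 2-coloring $\alpha$ of $E(K_N)$ with $|\alpha^{ -1}(R)|>m$ and $|\alpha^{ -1}(B)|>m$ contains a balanced copy of $G$. -}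

module Defs where

open import Data.Fin.Base using (Fin)
open import Data.Fin.Properties using (_≟_; _<?_)
open import Data.List.Base as List using (List; allFin; cartesianProduct; filter; length)
open import Data.Nat.Base as ℕ using (ℕ; _≤_; _≥_; _>_; ∣_-_∣)
open import Data.Nat.Combinatorics using (_C_)
open import Data.Nat.DivMod using (_/_)
open import Data.Product.Base as Product using (Σ-syntax; ∃-syntax; _×_; _,_)
open import Function.Definitions using (Injective)
open import Level using (0ℓ)
open import Relation.Binary.Core using (Rel)
open import Relation.Binary.Definitions
  using (Decidable; DecidableEquality; Irreflexive; Symmetric)
open import Relation.Binary.PropositionalEquality.Core using (_≡_; _≢_; refl; ≢-sym)
open import Relation.Nullary.Decidable.Core using (yes; no; ¬?; _×-dec_)

record Graph (n : ℕ) : Set₁ where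
  field
    Adjacent  : Rel (Fin n) 0ℓ
    adjacent? : Decidable Adjacent
    symmetric : Symmetric Adjacent
    loopless  : Irreflexive _≡_ Adjacent

open Graph public

complete : (N : ℕ) → Graph N
complete N = record
  { Adjacent  = _≢_
  ; adjacent? = λ u v → ¬? (u ≟ v)
  ; symmetric = ≢-sym
  ; loopless  = λ u≡v u≢v → u≢v u≡v
  }

-- Each edge is listed once, as the pair of its endpoints in increasing order.
edges : ∀ {n} → Graph n → List (Fin n × Fin n)
edges {n} G =
  filter (λ (u , v) → (u <? v) ×-dec adjacent? G u v)
         (cartesianProduct (allFin n) (allFin n))

degree : ∀ {n} → Graph n → Fin n → ℕ
degree {n} G v = length (filter (adjacent? G v) (allFin n))

Regular : ∀ {n} → ℕ → Graph n → Set
Regular d G = ∀ v → degree G v ≡ d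

data Side : Set where
  left right : Side

Bipartite : ∀ {n} → Graph n → Set
Bipartite {n} G =
  Σ[ side ∈ (Fin n → Side) ] (∀ u v → Adjacent G u v → side u ≢ side v)

data Color : Set where
  red blue : Color

_≟ᶜ_ : DecidableEquality Color
red  ≟ᶜ red  = yes refl
red  ≟ᶜ blue = no λ ()
blue ≟ᶜ red  = no λ ()
blue ≟ᶜ blue = yes refl

-- A function on the unordered pairs of distinct vertices, presented as a
-- symmetric function of two vertices. The values on the diagonal carry no
-- meaning and are never counted.
record Coloring (N : ℕ) : Set where
  field
    color     : Fin N → Fin N → Color
    color-sym : ∀ u v → color u v ≡ color v u

open Coloring public

count : ∀ {N} → Coloring N → Color → List (Fin N × Fin N) → ℕ
count α c es = length (filter (λ (u , v) → color α u v ≟ᶜ c) es)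

classSize : ∀ {N} → Coloring N → Color → ℕ
classSize {N} α c = count α c (edges (complete N))

-- A not necessarily induced subgraph of H together with an isomorphism from G
-- onto it: the subgraph has the image of `embed` as its vertex set and the
-- images of the edges of G as its edges.
record Copy {n N} (G : Graph n) (H : Graph N) : Set where
  field
    embed     : Fin n → Fin N
    injective : Injective _≡_ _≡_ embed
    preserves : ∀ u v → Adjacent G u v → Adjacent H (embed u) (embed v)

  -- As G-edges are listed once and `embed` is injective, so are these,
  -- though their endpoints need not be in increasing order.
  copyEdges : List (Fin N × Fin N)
  copyEdges = List.map (Product.map embed embed) (edges G)

open Copy public

ContainsBalancedCopy : ∀ {n N} → Coloring N → Graph n → Set
ContainsBalancedCopy {N = N} α G =
  Σ[ K ∈ Copy G (complete N) ]
    ∣ count α red (copyEdges K) - count α blue (copyEdges K) ∣ ≤ 1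

Balanceable : ∀ {n} → Graph n → Set
Balanceable G =
  ∃[ N₀ ] ∀ N → N ≥ N₀ →
    ∃[ m ] m ℕ.< (N C 2) / 2 ×
      (∀ (α : Coloring N) → classSize α red > m → classSize α blue > m →
        ContainsBalancedCopy α G)

{-# OPTIONS --safe #-}
module Submission where

-- If both colors have density bounded away from 0, then a positive proportion of the vertices are
-- mixed, that is, have linear degree in both colors: otherwise linearly many vertices have few red
-- edges and linearly many have few blue ones, and the pairs between the two kinds cannot be colored.
-- Picking common neighbours of mixed vertices one by one, at each step the most popular one, gives
-- a hub F of 4n vertices together with 4n vertices joined to F in red only and 4n joined to F in
-- blue only. Put the right side of G into F, half of the left side on red neighbours of F and the
-- other half on blue ones: as G is d-regular, either color gets d edges for each of n left vertices.

import Algebra.Properties.Semiring.Sum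
open import Data.Bool.Base using (Bool; true; false; not; _∧_; if_then_else_)
open import Data.Fin.Base using (Fin; zero; suc)
open import Data.Fin.Properties using (_≟_; _<?_; any?; all?; <-cmp; suc-injective)
open import Data.List.Base as List
  using (List; []; _∷_; _++_; allFin; cartesianProduct; filter; length; tabulate)
open import Data.List.Properties using (map-∘; map-++)
open import Data.Maybe.Base using (Maybe; just; nothing)
open import Data.Nat.Base
  using (ℕ; zero; suc; _+_; _*_; _^_; _≤_; _<_; _≥_; _>_; z≤n; s≤s; s≤s⁻¹; NonZero; >-nonZero)
open import Data.Nat.Combinatorics using (_C_; nC1≡n; nCk+nC[k+1]≡[n+1]C[k+1])
open import Data.Nat.DivMod
  using (_/_; _%_; m≡m%n+[m/n]*n; m%n<n; m*n/n≡m; /-monoˡ-≤; m/n*n≤m)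
import Data.Nat.ListAction as ListAction
open import Data.Nat.ListAction.Properties using (sum-++)
open import Data.Nat.Properties hiding (_≟_; _<?_; <-cmp; suc-injective)
open import Data.Nat.Tactic.RingSolver using (solve-∀)
open import Data.Product.Base as Product
  using (Σ-syntax; ∃-syntax; _×_; _,_; proj₁; proj₂)
open import Function.Base using (_∘_; id; it)
open import Function.Bundles using (mk⇔)
open import Function.Definitions using (Injective)
open import Level using (0ℓ)
open import Relation.Binary.Definitions using (tri<; tri≈; tri>)
open import Relation.Binary.PropositionalEquality hiding ([_])
open import Relation.Nullary using (Dec; yes; no; does; ¬_; ¬?; contradiction; _×-dec_)
open import Relation.Nullary.Decidable using (dec-true; dec-false; does-⇔)
open import Relation.Unary using (Pred; Decidable)
open import Defs

open Algebra.Properties.Semiring.Sum +-*-semiring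
  using (sum; sum-syntax; sum-cong-≗; ∑-distrib-+; ∑-comm; *-distribˡ-sum; *-distribʳ-sum)

private
  variable
    k n N : ℕ
    A B : Set

-- Sums over Fin n and cardinalities

sum-mono-≤ : {f g : Fin n → ℕ} → (∀ i → f i ≤ g i) → sum f ≤ sum g
sum-mono-≤ {zero}  f≤g = z≤n
sum-mono-≤ {suc n} f≤g = +-mono-≤ (f≤g zero) (sum-mono-≤ (f≤g ∘ suc))

sum-const : ∀ n x → ∑[ i < n ] x ≡ n * x
sum-const zero    x = refl
sum-const (suc n) x = cong (x +_) (sum-const n x)

term≤sum : (f : Fin n → ℕ) (i : Fin n) → f i ≤ sum f
term≤sum f zero    = m≤m+n _ _
term≤sum f (suc i) = m≤n⇒m≤o+n (f zero) (term≤sum (f ∘ suc) i)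

[_] : Bool → ℕ
[ b ] = if b then 1 else 0

[]≤1 : ∀ b → [ b ] ≤ 1
[]≤1 true  = s≤s z≤n
[]≤1 false = z≤n

[∧] : ∀ a b → [ a ∧ b ] ≡ [ a ] * [ b ]
[∧] true  b = sym (+-identityʳ [ b ])
[∧] false b = refl

size : (Fin n → Bool) → ℕ
size S = ∑[ i < _ ] [ S i ]

size≤n : (S : Fin n → Bool) → size S ≤ n
size≤n {n} S = begin
  size S         ≤⟨ sum-mono-≤ ([]≤1 ∘ S) ⟩
  ∑[ i < n ] 1   ≡⟨ sum-const n 1 ⟩
  n * 1          ≡⟨ *-identityʳ n ⟩
  n              ∎
  where open ≤-Reasoning

∧-trueˡ : ∀ {a b} → a ∧ b ≡ true → a ≡ true
∧-trueˡ {true} _ = refl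

∧-trueʳ : ∀ {a b} → a ∧ b ≡ true → b ≡ true
∧-trueʳ {true} eq = eq

does-true⇒ : (a? : Dec A) → does a? ≡ true → A
does-true⇒ (yes a) _ = a

size-singleton : (x : Fin n) → size (λ y → does (x ≟ y)) ≡ 1
size-singleton {suc n} zero    = cong suc (trans (sum-const n 0) (*-zeroʳ n))
size-singleton {suc n} (suc x) = size-singleton x

subset : (S : Fin n → Bool) (k : ℕ) → k ≤ size S →
         ∃[ T ] (∀ i → T i ≡ true → S i ≡ true) × size T ≡ k
subset {n} S zero _ =
  (λ _ → false) , (λ _ ()) , trans (sum-const n 0) (*-zeroʳ n)
subset {suc n} S (suc k) k<∣S∣ with S zero in S₀
... | false =
  let T , T⊆S , ∣T∣≡k = subset (S ∘ suc) (suc k) k<∣S∣ in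
  (λ { zero → false ; (suc i) → T i }) ,
  (λ { zero () ; (suc i) → T⊆S i }) , ∣T∣≡k
... | true =
  let T , T⊆S , ∣T∣≡k = subset (S ∘ suc) k (s≤s⁻¹ k<∣S∣) in
  (λ { zero → true ; (suc i) → T i }) ,
  (λ { zero _ → S₀ ; (suc i) → T⊆S i }) , cong suc ∣T∣≡k

injectInto : (S : Fin n → Bool) (k : ℕ) → k ≤ size S →
             Σ[ f ∈ (Fin k → Fin n) ] Injective _≡_ _≡_ f × (∀ i → S (f i) ≡ true)
injectInto S zero _ = (λ ()) , (λ { {()} }) , (λ ())
injectInto {suc n} S (suc k) k<∣S∣ with S zero in S₀
... | false =
  let f , f-inj , f∈S = injectInto (S ∘ suc) (suc k) k<∣S∣ in
  suc ∘ f , f-inj ∘ suc-injective , f∈S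
... | true =
  let f , f-inj , f∈S = injectInto (S ∘ suc) k (s≤s⁻¹ k<∣S∣) in
  (λ { zero → zero ; (suc i) → suc (f i) }) ,
  (λ { {zero} {zero} _ → refl
     ; {suc i} {suc j} eq → cong suc (f-inj (suc-injective eq)) }) ,
  (λ { zero → S₀ ; (suc i) → f∈S i })

_∩_ : (Fin n → Bool) → (Fin n → Bool) → Fin n → Bool
(S ∩ T) i = S i ∧ T i

-- Popular common neighbours

-- Double counting of the pairs x, v with `v` in `S` and `E x v`: there are at least
-- `n * size S / 64` of them. The vertices already listed in `a` lie in at most `k * size S` pairs,
-- which is at most `n * size S / 256`. If every other `x` lay in at most `size S / 256` pairs, the
-- total would be at most `n * size S / 128`, a contradiction.
commonNeighbour :
  (E : Fin n → Fin n → Bool) (S : Fin n → Bool) (a : Fin k → Fin n) →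
  0 < n → 256 * k ≤ n → 0 < size S →
  (∀ v → S v ≡ true → n ≤ 64 * size (λ x → E x v)) →
  ∃[ x ] (∀ i → a i ≢ x) × size S ≤ 256 * size (S ∩ E x)
commonNeighbour {n} {k} E S a n>0 256k≤n ∣S∣>0 heavy
  with any? (λ x → all? (λ i → ¬? (a i ≟ x)) ×-dec (size S ≤? 256 * size (S ∩ E x)))
... | yes found = found
... | no none = contradiction 4n∣S∣≤2n∣S∣ (<⇒≱ (*-monoˡ-< (n * size S) {{>-nonZero (*-mono-< n>0 ∣S∣>0)}} 2<4))
  where
  open ≤-Reasoning
  2<4 : 2 < 4
  2<4 = s≤s (s≤s (s≤s z≤n))
  s : ℕ
  s = size S
  used : Fin n → ℕ
  used x = ∑[ i < k ] [ does (a i ≟ x) ]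

  -- The summand with `used x` is a penalty for vertices already chosen, where only the trivial
  -- bound by `s` is available. Summed over `x` it costs `256 * s * k`, hence at most `n * s`.
  few : ∀ x → 256 * size (S ∩ E x) ≤ s + 256 * s * used x
  few x with any? (λ i → a i ≟ x)
  ... | yes (i , aᵢ≡x) = begin
    256 * size (S ∩ E x)   ≤⟨ *-monoʳ-≤ 256 (sum-mono-≤ λ v → ∩≤ (S v) (E x v)) ⟩
    256 * s                ≡⟨ *-identityʳ (256 * s) ⟨
    256 * s * 1            ≡⟨ cong (λ b → 256 * s * [ b ]) (dec-true (a i ≟ x) aᵢ≡x) ⟨
    256 * s * [ does (a i ≟ x) ]
                           ≤⟨ *-monoʳ-≤ (256 * s) (term≤sum (λ i → [ does (a i ≟ x) ]) i) ⟩
    256 * s * used x       ≤⟨ m≤n+m _ s ⟩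
    s + 256 * s * used x   ∎
    where
    ∩≤ : ∀ p q → [ p ∧ q ] ≤ [ p ]
    ∩≤ true  q = []≤1 q
    ∩≤ false q = z≤n
  ... | no x-unused = begin
    256 * size (S ∩ E x)   ≤⟨ ≰⇒≥ (λ s≤ → none (x , (λ i aᵢ≡x → x-unused (i , aᵢ≡x)) , s≤)) ⟩
    s                      ≤⟨ m≤m+n s _ ⟩
    s + 256 * s * used x   ∎

  ∑used : ∑[ x < n ] used x ≡ k
  ∑used = begin-equality
    ∑[ x < n ] used x                            ≡⟨ ∑-comm (λ x i → [ does (a i ≟ x) ]) ⟩
    ∑[ i < k ] ∑[ x < n ] [ does (a i ≟ x) ]     ≡⟨ sum-cong-≗ (size-singleton ∘ a) ⟩
    ∑[ i < k ] 1                                 ≡⟨ sum-const k 1 ⟩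
    k * 1                                        ≡⟨ *-identityʳ k ⟩
    k                                            ∎

  many : n * s ≤ 64 * ∑[ x < n ] size (S ∩ E x)
  many = begin
    n * s                                        ≡⟨ *-distribˡ-sum n (λ v → [ S v ]) ⟩
    ∑[ v < n ] (n * [ S v ])                     ≤⟨ sum-mono-≤ pointwise ⟩
    ∑[ v < n ] (64 * ∑[ x < n ] [ S v ∧ E x v ]) ≡⟨ *-distribˡ-sum 64 (λ v → ∑[ x < n ] [ S v ∧ E x v ]) ⟨
    64 * ∑[ v < n ] ∑[ x < n ] [ S v ∧ E x v ]   ≡⟨ cong (64 *_) (∑-comm (λ v x → [ S v ∧ E x v ])) ⟩
    64 * ∑[ x < n ] size (S ∩ E x)               ∎
    where
    pointwise : ∀ v → n * [ S v ] ≤ 64 * ∑[ x < n ] [ S v ∧ E x v ]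
    pointwise v with S v in v∈S
    ... | true  = ≤-trans (≤-reflexive (*-identityʳ n)) (heavy v v∈S)
    ... | false = ≤-trans (≤-reflexive (*-zeroʳ n)) z≤n

  4n∣S∣≤2n∣S∣ : 4 * (n * s) ≤ 2 * (n * s)
  4n∣S∣≤2n∣S∣ = begin
    4 * (n * s)                                  ≤⟨ *-monoʳ-≤ 4 many ⟩
    4 * (64 * ∑[ x < n ] size (S ∩ E x))         ≡⟨ *-assoc 4 64 (∑[ x < n ] size (S ∩ E x)) ⟨
    256 * ∑[ x < n ] size (S ∩ E x)              ≡⟨ *-distribˡ-sum 256 (λ x → size (S ∩ E x)) ⟩
    ∑[ x < n ] (256 * size (S ∩ E x))            ≤⟨ sum-mono-≤ few ⟩
    ∑[ x < n ] (s + 256 * s * used x)            ≡⟨ ∑-distrib-+ (λ _ → s) (λ x → 256 * s * used x) ⟩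
    ∑[ x < n ] s + ∑[ x < n ] (256 * s * used x) ≡⟨ cong₂ _+_ (sum-const n s) (sym (*-distribˡ-sum (256 * s) used)) ⟩
    n * s + 256 * s * ∑[ x < n ] used x          ≡⟨ cong (λ t → n * s + 256 * s * t) ∑used ⟩
    n * s + 256 * s * k                          ≡⟨ cong (n * s +_) (xy·z≡xz·y 256 s k) ⟩
    n * s + 256 * k * s                          ≤⟨ +-monoʳ-≤ (n * s) (*-monoˡ-≤ s 256k≤n) ⟩
    n * s + n * s                                ≡⟨ cong (n * s +_) (+-identityʳ (n * s)) ⟨
    2 * (n * s)                                  ∎
    where
    xy·z≡xz·y : ∀ x y z → x * y * z ≡ x * z * y
    xy·z≡xz·y = solve-∀

-- Greedy choice: each new vertex replaces the current set by its neighbours in that set and so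
-- divides its size by at most 256. The size bound keeps the set nonempty, and the degree bound
-- passes to subsets, so the next choice is possible.
commonNeighbours :
  (E : Fin n → Fin n → Bool) (S : Fin n → Bool) (k : ℕ) →
  0 < n → 256 * k ≤ n → 0 < size S →
  (∀ v → S v ≡ true → n ≤ 64 * size (λ x → E x v)) →
  Σ[ a ∈ (Fin k → Fin n) ] ∃[ T ]
    Injective _≡_ _≡_ a × (∀ v → T v ≡ true → S v ≡ true) ×
    (∀ i v → T v ≡ true → E (a i) v ≡ true) × size S ≤ 256 ^ k * size T
commonNeighbours E S zero _ _ _ _ =
  (λ ()) , S , (λ { {()} }) , (λ _ → id) , (λ ()) , ≤-reflexive (sym (*-identityˡ _))
commonNeighbours {n} E S (suc k) n>0 256[1+k]≤n ∣S∣>0 heavy =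
  let 256k≤n = ≤-trans (*-monoʳ-≤ 256 (n≤1+n k)) 256[1+k]≤n
      a , T , a-inj , T⊆S , joined , ∣S∣≤ = commonNeighbours E S k n>0 256k≤n ∣S∣>0 heavy
      ∣T∣>0 = n≢0⇒n>0 λ ∣T∣≡0 → <⇒≱ ∣S∣>0
                (≤-trans ∣S∣≤ (≤-reflexive (trans (cong (256 ^ k *_) ∣T∣≡0) (*-zeroʳ (256 ^ k)))))
      x , x-new , ∣T∣≤ = commonNeighbour E T a n>0 256k≤n ∣T∣>0 (λ v → heavy v ∘ T⊆S v)
  in (λ { zero → x ; (suc i) → a i }) , T ∩ E x ,
     (λ { {zero} {zero} _ → refl
        ; {zero} {suc j} x≡aⱼ → contradiction (sym x≡aⱼ) (x-new j)
        ; {suc i} {zero} aᵢ≡x → contradiction aᵢ≡x (x-new i)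
        ; {suc i} {suc j} eq → cong suc (a-inj eq) }) ,
     (λ v → T⊆S v ∘ ∧-trueˡ) ,
     (λ { zero v v∈ → ∧-trueʳ {T v} v∈ ; (suc i) v v∈ → joined i v (∧-trueˡ v∈) }) ,
     (begin
       size S                                 ≤⟨ ∣S∣≤ ⟩
       256 ^ k * size T                       ≤⟨ *-monoʳ-≤ (256 ^ k) ∣T∣≤ ⟩
       256 ^ k * (256 * size (T ∩ E x))       ≡⟨ *-assoc (256 ^ k) 256 _ ⟨
       256 ^ k * 256 * size (T ∩ E x)         ≡⟨ cong (_* size (T ∩ E x)) (*-comm (256 ^ k) 256) ⟩
       256 ^ suc k * size (T ∩ E x)           ∎)
  where open ≤-Reasoning

-- Mixed vertices

light : (Fin n → ℕ) → Fin n → Bool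
light {n} f v = does (suc (64 * f v) ≤? n)

light⇒< : (f : Fin n → ℕ) (v : Fin n) → light f v ≡ true → 64 * f v < n
light⇒< {n} f v = does-true⇒ (suc (64 * f v) ≤? n)

¬light⇒≥ : (f : Fin n → ℕ) (v : Fin n) → light f v ≡ false → n ≤ 64 * f v
¬light⇒≥ {n} f v eq =
  ≮⇒≥ λ f< → contradiction (trans (sym eq) (dec-true (suc (64 * f v) ≤? n) f<)) λ ()

-- For `g` and `h` the degrees in the two colors and `M` the mixed vertices. Vertices light for `g`
-- contribute at most `n * n / 64` to `sum g`; the others contribute at most `n` each and are light
-- for `h` or lie in `M`. With `M` smaller than `n / 64`, a fraction of at least 1/4 - 1/64 - 1/64 =
-- 7/32 of the vertices is light for `h`.
manyLight : (g h : Fin n → ℕ) (M : Fin n → Bool) → 0 < n → (∀ v → g v ≤ n) →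
            n * n ≤ 4 * sum g →
            (∀ v → light g v ≡ false → light h v ≡ false → M v ≡ true) →
            64 * size M < n → 7 * n ≤ 32 * size (light h)
manyLight {n} g h M n>0 g≤n n²≤4∑g M-spec 64m<n =
  *-cancelˡ-≤ 8 (+-cancelˡ-≤ (8 * n) _ _ (*-cancelˡ-≤ n {{>-nonZero n>0}} bound))
  where
  open ≤-Reasoning
  q m : ℕ
  q = size (light h)
  m = size M

  pointwise : ∀ v → 64 * g v ≤ n + 64 * n * ([ light h v ] + [ M v ])
  pointwise v with light g v in g-light | light h v in h-light
  ... | true  | _    = ≤-trans (<⇒≤ (light⇒< g v g-light)) (m≤m+n n _)
  ... | false | true = begin
    64 * g v                          ≤⟨ *-monoʳ-≤ 64 (g≤n v) ⟩
    64 * n                            ≡⟨ *-identityʳ (64 * n) ⟨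
    64 * n * 1                        ≤⟨ *-monoʳ-≤ (64 * n) (m≤m+n 1 [ M v ]) ⟩
    64 * n * (1 + [ M v ])            ≤⟨ m≤n+m _ n ⟩
    n + 64 * n * (1 + [ M v ])        ∎
  ... | false | false rewrite M-spec v g-light h-light = begin
    64 * g v                          ≤⟨ *-monoʳ-≤ 64 (g≤n v) ⟩
    64 * n                            ≡⟨ *-identityʳ (64 * n) ⟨
    64 * n * 1                        ≤⟨ m≤n+m _ n ⟩
    n + 64 * n * 1                    ∎

  64∑g≤ : 64 * sum g ≤ n * n + 64 * n * (q + m)
  64∑g≤ = begin
    64 * sum g
      ≡⟨ *-distribˡ-sum 64 g ⟩
    ∑[ v < n ] (64 * g v)
      ≤⟨ sum-mono-≤ pointwise ⟩
    ∑[ v < n ] (n + 64 * n * ([ light h v ] + [ M v ]))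
      ≡⟨ ∑-distrib-+ (λ _ → n) (λ v → 64 * n * ([ light h v ] + [ M v ])) ⟩
    ∑[ v < n ] n + ∑[ v < n ] (64 * n * ([ light h v ] + [ M v ]))
      ≡⟨ cong₂ _+_ (sum-const n n) (sym (*-distribˡ-sum (64 * n) (λ v → [ light h v ] + [ M v ]))) ⟩
    n * n + 64 * n * ∑[ v < n ] ([ light h v ] + [ M v ])
      ≡⟨ cong (λ t → n * n + 64 * n * t) (∑-distrib-+ (λ v → [ light h v ]) (λ v → [ M v ])) ⟩
    n * n + 64 * n * (q + m)
      ∎

  -- Both sides are shaped so that the factor `n`, the summand `8 * n` and the factor 8 cancel in
  -- turn.
  bound : n * (8 * n + 8 * (7 * n)) ≤ n * (8 * n + 8 * (32 * q))
  bound = begin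
    n * (8 * n + 8 * (7 * n))                  ≡⟨ i₁ n ⟩
    64 * (n * n)                               ≤⟨ *-monoʳ-≤ 64 n²≤4∑g ⟩
    64 * (4 * sum g)                           ≡⟨ i₂ (sum g) ⟩
    4 * (64 * sum g)                           ≤⟨ *-monoʳ-≤ 4 64∑g≤ ⟩
    4 * (n * n + 64 * n * (q + m))             ≡⟨ i₃ n q m ⟩
    n * (4 * n + 4 * (64 * m) + 8 * (32 * q))  ≤⟨ *-monoʳ-≤ n (+-monoˡ-≤ (8 * (32 * q))
                                                    (+-monoʳ-≤ (4 * n) (*-monoʳ-≤ 4 (<⇒≤ 64m<n)))) ⟩
    n * (4 * n + 4 * n + 8 * (32 * q))         ≡⟨ i₄ n q ⟩
    n * (8 * n + 8 * (32 * q))                 ∎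
    where
    i₁ : ∀ n → n * (8 * n + 8 * (7 * n)) ≡ 64 * (n * n)
    i₁ = solve-∀
    i₂ : ∀ s → 64 * (4 * s) ≡ 4 * (64 * s)
    i₂ = solve-∀
    i₃ : ∀ n q m → 4 * (n * n + 64 * n * (q + m)) ≡ n * (4 * n + 4 * (64 * m) + 8 * (32 * q))
    i₃ = solve-∀
    i₄ : ∀ n q → n * (4 * n + 4 * n + 8 * (32 * q)) ≡ n * (8 * n + 8 * (32 * q))
    i₄ = solve-∀

-- The diagonal is excluded because the values of `color` there are meaningless; thus being joined
-- also certifies that the two vertices are distinct.
joined : Coloring N → Color → Fin N → Fin N → Bool
joined α c u v = not (does (u ≟ v)) ∧ does (color α u v ≟ᶜ c)

joined⇒color : (α : Coloring N) (c : Color) (u v : Fin N) → joined α c u v ≡ true → color α u v ≡ c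
joined⇒color α c u v eq = does-true⇒ (color α u v ≟ᶜ c) (∧-trueʳ {not (does (u ≟ v))} eq)

joined⇒≢ : (α : Coloring N) (c : Color) (u v : Fin N) → joined α c u v ≡ true → u ≢ v
joined⇒≢ α c u v eq with u ≟ v
... | no u≢v = u≢v

colorDegree : Coloring N → Color → Fin N → ℕ
colorDegree α c v = size (λ x → joined α c x v)

-- Let `P` be the vertices with few blue edges, `Q` those with few red ones, and `M` the rest. If
-- `M` were small, `manyLight` would make both `P` and `Q` large. But a pair from `P` and `Q` is
-- blue, red or diagonal, and there are too few blue edges at `P`, red edges at `Q` and diagonal
-- pairs to account for all of them.
manyMixed : (α : Coloring N) → 64 ≤ N →
            (∀ c → N * N ≤ 4 * sum (colorDegree α c)) →
            ∃[ M ] (∀ c v → M v ≡ true → N ≤ 64 * colorDegree α c v) × N ≤ 64 * size M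
manyMixed {N} α 64≤N dense =
  M , M-heavy , ≮⇒≥ few-impossible
  where
  open ≤-Reasoning
  P Q M : Fin N → Bool
  P = light (colorDegree α blue)
  Q = light (colorDegree α red)
  M v = not (Q v) ∧ not (P v)

  not-true : ∀ {b} → not b ≡ true → b ≡ false
  not-true {false} _ = refl

  M-heavy : ∀ c v → M v ≡ true → N ≤ 64 * colorDegree α c v
  M-heavy red  v v∈M = ¬light⇒≥ (colorDegree α red) v (not-true (∧-trueˡ v∈M))
  M-heavy blue v v∈M = ¬light⇒≥ (colorDegree α blue) v (not-true (∧-trueʳ {not (Q v)} v∈M))

  N>0 : 0 < N
  N>0 = ≤-trans (s≤s z≤n) 64≤N

  -- A blue pair is charged to its end `u` in `P`, a red one to its end `v` in `Q`. The argument
  -- orders of `joined` make the later sums literally values of `colorDegree`.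
  cover : ∀ u v → [ P u ] * [ Q v ] ≤
          [ P u ] * [ joined α blue v u ] + [ Q v ] * [ joined α red u v ] + [ does (u ≟ v) ]
  cover u v with P u | Q v
  ... | false | _     = z≤n
  ... | true  | false = z≤n
  ... | true  | true  rewrite color-sym α v u with u ≟ v | v ≟ u
  ...   | yes _  | _      = m≤n+m 1 _
  ...   | no u≢v | yes v≡u = contradiction (sym v≡u) u≢v
  ...   | no _   | no _   with color α u v
  ...     | red  = s≤s z≤n
  ...     | blue = s≤s z≤n

  lightSum : ∀ c → 64 * ∑[ v < N ] ([ light (colorDegree α c) v ] * colorDegree α c v) ≤ N * N
  lightSum c = begin
    64 * ∑[ v < N ] ([ light δ v ] * δ v)    ≡⟨ *-distribˡ-sum 64 (λ v → [ light δ v ] * δ v) ⟩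
    ∑[ v < N ] (64 * ([ light δ v ] * δ v))  ≤⟨ sum-mono-≤ pointwise ⟩
    ∑[ v < N ] N                             ≡⟨ sum-const N N ⟩
    N * N                                    ∎
    where
    δ : Fin N → ℕ
    δ = colorDegree α c
    pointwise : ∀ v → 64 * ([ light δ v ] * δ v) ≤ N
    pointwise v with light δ v in eq
    ... | true  = ≤-trans (≤-reflexive (cong (64 *_) (+-identityʳ (δ v)))) (<⇒≤ (light⇒< δ v eq))
    ... | false = z≤n

  p q : ℕ
  p = size P
  q = size Q

  p*q≤ : p * q ≤ ∑[ u < N ] ([ P u ] * colorDegree α blue u) +
                 ∑[ v < N ] ([ Q v ] * colorDegree α red v) + N
  p*q≤ = begin
    p * q
      ≡⟨ *-distribʳ-sum q (λ u → [ P u ]) ⟩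
    ∑[ u < N ] ([ P u ] * q)
      ≡⟨ sum-cong-≗ (λ u → *-distribˡ-sum [ P u ] (λ v → [ Q v ])) ⟩
    ∑[ u < N ] ∑[ v < N ] ([ P u ] * [ Q v ])
      ≤⟨ sum-mono-≤ (λ u → sum-mono-≤ (cover u)) ⟩
    ∑[ u < N ] ∑[ v < N ] (x u v + y u v + z u v)
      ≡⟨ sum-cong-≗ (λ u → trans (∑-distrib-+ (λ v → x u v + y u v) (z u))
                                 (cong (_+ sum (z u)) (∑-distrib-+ (x u) (y u)))) ⟩
    ∑[ u < N ] (sum (x u) + sum (y u) + sum (z u))
      ≡⟨ trans (∑-distrib-+ (λ u → sum (x u) + sum (y u)) (sum ∘ z))
               (cong (_+ sum (sum ∘ z)) (∑-distrib-+ (sum ∘ x) (sum ∘ y))) ⟩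
    sum (sum ∘ x) + sum (sum ∘ y) + sum (sum ∘ z)
      ≡⟨ cong₂ _+_ (cong₂ _+_
           (sum-cong-≗ λ u → sym (*-distribˡ-sum [ P u ] (λ v → [ joined α blue v u ])))
           (trans (∑-comm y)
             (sum-cong-≗ λ v → sym (*-distribˡ-sum [ Q v ] (λ u → [ joined α red u v ])))))
           (trans (sum-cong-≗ {N} size-singleton) (trans (sum-const N 1) (*-identityʳ N))) ⟩
    ∑[ u < N ] ([ P u ] * colorDegree α blue u) +
      ∑[ v < N ] ([ Q v ] * colorDegree α red v) + N
      ∎
    where
    x y z : Fin N → Fin N → ℕ
    x u v = [ P u ] * [ joined α blue v u ]
    y u v = [ Q v ] * [ joined α red u v ]
    z u v = [ does (u ≟ v) ]

  few-impossible : ¬ 64 * size M < N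
  few-impossible 64m<N =
    <⇒≱ (*-monoˡ-< (N * N) {{>-nonZero (*-mono-< N>0 N>0)}} (n<1+n 48)) 49N²≤48N²
    where
    7N≤32p : 7 * N ≤ 32 * p
    7N≤32p = manyLight (colorDegree α red) (colorDegree α blue) M N>0 (λ v → size≤n (λ x → joined α red x v))
               (dense red) (λ v l h → cong₂ (λ a b → not a ∧ not b) l h) 64m<N
    7N≤32q : 7 * N ≤ 32 * q
    7N≤32q = manyLight (colorDegree α blue) (colorDegree α red) M N>0 (λ v → size≤n (λ x → joined α blue x v))
               (dense blue) (λ v h l → cong₂ (λ a b → not a ∧ not b) l h) 64m<N
    X Y : ℕ
    X = ∑[ u < N ] ([ P u ] * colorDegree α blue u)
    Y = ∑[ v < N ] ([ Q v ] * colorDegree α red v)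
    49N²≤48N² : 49 * (N * N) ≤ 48 * (N * N)
    -- The product of the two densities is at least (7/32)², that is 49/1024, while blue, red and
    -- diagonal pairs cover at most 3/64, that is 48/1024. The diagonal takes its share of 1/64 by
    -- `64≤N`.
    49N²≤48N² = begin
      49 * (N * N)                            ≡⟨ i₁ N ⟩
      (7 * N) * (7 * N)                       ≤⟨ *-mono-≤ 7N≤32p 7N≤32q ⟩
      (32 * p) * (32 * q)                     ≡⟨ i₂ p q ⟩
      16 * (64 * (p * q))                     ≤⟨ *-monoʳ-≤ 16 (*-monoʳ-≤ 64 p*q≤) ⟩
      16 * (64 * (X + Y + N))                 ≡⟨ i₃ X Y N ⟩
      16 * (64 * X + 64 * Y + 64 * N)         ≤⟨ *-monoʳ-≤ 16 (+-mono-≤ (+-mono-≤ (lightSum blue) (lightSum red))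
                                                   (*-monoˡ-≤ N 64≤N)) ⟩
      16 * (N * N + N * N + N * N)            ≡⟨ i₄ N ⟩
      48 * (N * N)                            ∎
      where
      i₁ : ∀ n → 49 * (n * n) ≡ (7 * n) * (7 * n)
      i₁ = solve-∀
      i₂ : ∀ p q → (32 * p) * (32 * q) ≡ 16 * (64 * (p * q))
      i₂ = solve-∀
      i₃ : ∀ x y n → 16 * (64 * (x + y + n)) ≡ 16 * (64 * x + 64 * y + 64 * n)
      i₃ = solve-∀
      i₄ : ∀ n → 16 * (n * n + n * n + n * n) ≡ 48 * (n * n)
      i₄ = solve-∀

-- Hub patterns

-- Collects the losses of the construction: a factor `c` for passing to mixed vertices, then a
-- factor `K` for the common neighbours in each of the two colors.
cancelChain : ∀ c K {N m s t r} .{{_ : NonZero c}} .{{_ : NonZero K}} →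
              c * (K * K) * r ≤ N → N ≤ c * m → m ≤ K * s → s ≤ K * t → r ≤ t
cancelChain c K {N} {m} {s} {t} {r} cKKr≤N N≤cm m≤Ks s≤Kt =
  *-cancelˡ-≤ (c * (K * K)) {{m*n≢0 c (K * K) {{it}} {{m*n≢0 K K}}}} (begin
    c * (K * K) * r     ≤⟨ cKKr≤N ⟩
    N                   ≤⟨ N≤cm ⟩
    c * m               ≤⟨ *-monoʳ-≤ c (≤-trans m≤Ks (*-monoʳ-≤ K s≤Kt)) ⟩
    c * (K * (K * t))   ≡⟨ cong (c *_) (*-assoc K K t) ⟨
    c * (K * K * t)     ≡⟨ *-assoc c (K * K) t ⟨
    c * (K * K) * t     ∎)
  where open ≤-Reasoning

factor>0 : ∀ {x y} c → 0 < x → x ≤ c * y → 0 < y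
factor>0 {x} {zero}  c x>0 x≤cy = contradiction (≤-trans x≤cy (≤-reflexive (*-zeroʳ c))) (<⇒≱ x>0)
factor>0 {x} {suc y} c _   _    = s≤s z≤n

-- The hub f is joined in color c to all of g c; hence the images of f, g red and g blue are
-- disjoint.
HubPattern : Coloring N → ℕ → Set
HubPattern {N} α t =
  Σ[ f ∈ (Fin t → Fin N) ] Σ[ g ∈ (Color → Fin t → Fin N) ]
    Injective _≡_ _≡_ f × (∀ c → Injective _≡_ _≡_ (g c)) ×
    (∀ c i j → joined α c (g c i) (f j) ≡ true)

-- Starting from the mixed vertices, the red common neighbours cut them down to `S`, and the blue
-- ones cut `S` down to `T`. The vertices of `S` are still mixed, so their blue degrees suffice for
-- the second round. Any `t` vertices of `T` serve as the hub.
hubPattern : (t : ℕ) (α : Coloring N) → 64 ≤ N → 256 * t ≤ N →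
             64 * (256 ^ t * 256 ^ t) * t ≤ N →
             (∀ c → N * N ≤ 4 * sum (colorDegree α c)) → HubPattern α t
hubPattern {N} t α 64≤N 256t≤N large dense =
  let N>0 = ≤-trans (s≤s z≤n) 64≤N
      M , heavy , N≤64m = manyMixed α 64≤N dense
      m>0 = factor>0 64 N>0 N≤64m
      a , S , a-inj , S⊆M , a~S , m≤ =
        commonNeighbours (joined α red) M t N>0 256t≤N m>0 (heavy red)
      s>0 = factor>0 (256 ^ t) m>0 m≤
      b , T , b-inj , T⊆S , b~T , s≤ =
        commonNeighbours (joined α blue) S t N>0 256t≤N s>0 (λ v v∈S → heavy blue v (S⊆M v v∈S))
      t≤∣T∣ = cancelChain 64 (256 ^ t) {{_}} {{m^n≢0 256 t}} large N≤64m m≤ s≤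
      f , f-inj , f∈T = injectInto T t t≤∣T∣
  in f , (λ { red → a ; blue → b }) , f-inj , (λ { red → a-inj ; blue → b-inj }) ,
     λ { red i j → a~S i (f j) (T⊆S (f j) (f∈T j)) ; blue i j → b~T i (f j) (f∈T j) }

-- Counting edges

total : (A → ℕ) → List A → ℕ
total w xs = ListAction.sum (List.map w xs)

length-filter : {P : Pred A 0ℓ} (P? : Decidable P) (xs : List A) →
                length (filter P? xs) ≡ total (λ x → [ does (P? x) ]) xs
length-filter P? []       = refl
length-filter P? (x ∷ xs) with does (P? x)
... | true  = cong suc (length-filter P? xs)
... | false = length-filter P? xs

total-filter : {P : Pred A 0ℓ} (P? : Decidable P) (w : A → ℕ) (xs : List A) →
               total w (filter P? xs) ≡ total (λ x → [ does (P? x) ] * w x) xs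
total-filter P? w []       = refl
total-filter P? w (x ∷ xs) with does (P? x)
... | true  = cong₂ _+_ (sym (+-identityʳ (w x))) (total-filter P? w xs)
... | false = total-filter P? w xs

total-map : (f : A → B) (w : B → ℕ) (xs : List A) → total w (List.map f xs) ≡ total (w ∘ f) xs
total-map f w xs = cong ListAction.sum (sym (map-∘ xs))

total-++ : (w : A → ℕ) (xs ys : List A) → total w (xs ++ ys) ≡ total w xs + total w ys
total-++ w xs ys = trans (cong ListAction.sum (map-++ w xs ys)) (sum-++ (List.map w xs) (List.map w ys))

total-cartesianProduct : (w : A × B → ℕ) (xs : List A) (ys : List B) →
  total w (cartesianProduct xs ys) ≡ total (λ x → total (λ y → w (x , y)) ys) xs
total-cartesianProduct w []       ys = refl
total-cartesianProduct w (x ∷ xs) ys = begin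
  total w (List.map (x ,_) ys ++ cartesianProduct xs ys)
    ≡⟨ total-++ w (List.map (x ,_) ys) (cartesianProduct xs ys) ⟩
  total w (List.map (x ,_) ys) + total w (cartesianProduct xs ys)
    ≡⟨ cong₂ _+_ (total-map (x ,_) w ys) (total-cartesianProduct w xs ys) ⟩
  total (λ y → w (x , y)) ys + total (λ x → total (λ y → w (x , y)) ys) xs
    ∎
  where open ≡-Reasoning

total-tabulate : (w : A → ℕ) (f : Fin n → A) → total w (tabulate f) ≡ sum (w ∘ f)
total-tabulate {n = zero}  w f = refl
total-tabulate {n = suc n} w f = cong (w (f zero) +_) (total-tabulate w (f ∘ suc))

total-pairs : (w : Fin n × Fin n → ℕ) →
  total w (cartesianProduct (allFin n) (allFin n)) ≡ ∑[ u < n ] ∑[ v < n ] w (u , v)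
total-pairs {n} w = begin
  total w (cartesianProduct (allFin n) (allFin n))
    ≡⟨ total-cartesianProduct w (allFin n) (allFin n) ⟩
  total (λ u → total (λ v → w (u , v)) (allFin n)) (allFin n)
    ≡⟨ total-tabulate (λ u → total (λ v → w (u , v)) (allFin n)) id ⟩
  ∑[ u < n ] total (λ v → w (u , v)) (allFin n)
    ≡⟨ sum-cong-≗ {n} (λ u → total-tabulate (λ v → w (u , v)) id) ⟩
  ∑[ u < n ] ∑[ v < n ] w (u , v)
    ∎
  where open ≡-Reasoning

-- Exchanging the names of the summation variables in the part with `h v u` turns its condition into
-- `v` below `u`; together with the other part this meets each off-diagonal ordered pair exactly
-- once.
∑-unordered : (h : Fin n → Fin n → ℕ) → (∀ u → h u u ≡ 0) →
  ∑[ u < n ] ∑[ v < n ] ([ does (u <? v) ] * (h u v + h v u)) ≡ ∑[ u < n ] ∑[ v < n ] h u v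
∑-unordered {n} h h-diag = begin
  ∑[ u < n ] ∑[ v < n ] (χ u v * (h u v + h v u))
    ≡⟨ sum-cong-≗ {n} (λ u → trans (sum-cong-≗ {n} (λ v → *-distribˡ-+ (χ u v) (h u v) (h v u)))
                                   (∑-distrib-+ (x u) (y u))) ⟩
  ∑[ u < n ] (sum (x u) + sum (y u))
    ≡⟨ ∑-distrib-+ (sum ∘ x) (sum ∘ y) ⟩
  sum (sum ∘ x) + sum (sum ∘ y)
    ≡⟨ cong (sum (sum ∘ x) +_) (∑-comm y) ⟩
  sum (sum ∘ x) + ∑[ u < n ] ∑[ v < n ] y v u
    ≡⟨ ∑-distrib-+ (sum ∘ x) (λ u → ∑[ v < n ] y v u) ⟨
  ∑[ u < n ] (sum (x u) + ∑[ v < n ] y v u)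
    ≡⟨ sum-cong-≗ {n} (λ u → trans (sym (∑-distrib-+ (x u) (λ v → y v u)))
                                   (sum-cong-≗ {n} (split u))) ⟩
  ∑[ u < n ] ∑[ v < n ] h u v
    ∎
  where
  open ≡-Reasoning
  χ x y : Fin n → Fin n → ℕ
  χ u v = [ does (u <? v) ]
  x u v = χ u v * h u v
  y u v = χ u v * h v u
  split : ∀ u v → x u v + y v u ≡ h u v
  split u v with <-cmp u v
  ... | tri< u<v _ v≮u rewrite dec-true (u <? v) u<v | dec-false (v <? u) v≮u =
    trans (+-identityʳ _) (+-identityʳ _)
  ... | tri≈ u≮u refl _ rewrite dec-false (u <? u) u≮u = sym (h-diag u)
  ... | tri> u≮v _ v<u rewrite dec-false (u <? v) u≮v | dec-true (v <? u) v<u = +-identityʳ _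

adj : Graph n → Fin n → Fin n → ℕ
adj G u v = [ does (adjacent? G u v) ]

adj-sym : (G : Graph n) (u v : Fin n) → adj G u v ≡ adj G v u
adj-sym G u v =
  cong [_] (does-⇔ (mk⇔ (symmetric G) (symmetric G)) (adjacent? G u v) (adjacent? G v u))

adj-diag : (G : Graph n) (u : Fin n) → adj G u u ≡ 0
adj-diag G u = cong [_] (dec-false (adjacent? G u u) (loopless G refl))

degree≡∑ : (G : Graph n) (v : Fin n) → degree G v ≡ ∑[ u < n ] adj G v u
degree≡∑ {n} G v =
  trans (length-filter (adjacent? G v) (allFin n)) (total-tabulate (λ u → adj G v u) id)

-- The weight of an edge is split into shares of its two ends, `h u v` being the share of `u`.
-- Regrouping the shares by vertex removes the ordering of endpoints built into `edges`. Doubled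
-- color indicators give the degree sum of a color; indicators of roles give the edge counts of a
-- copy.
handshake : (G : Graph n) (w : Fin n × Fin n → ℕ) (h : Fin n → Fin n → ℕ) →
  (∀ u v → Adjacent G u v → w (u , v) ≡ h u v + h v u) →
  total w (edges G) ≡ ∑[ u < n ] ∑[ v < n ] (adj G u v * h u v)
handshake {n} G w h w≡h+h = begin
  total w (edges G)
    ≡⟨ total-filter (λ (u , v) → (u <? v) ×-dec adjacent? G u v) w
         (cartesianProduct (allFin n) (allFin n)) ⟩
  total (λ (u , v) → [ does (u <? v) ∧ does (adjacent? G u v) ] * w (u , v))
        (cartesianProduct (allFin n) (allFin n))
    ≡⟨ total-pairs (λ (u , v) → [ does (u <? v) ∧ does (adjacent? G u v) ] * w (u , v)) ⟩
  ∑[ u < n ] ∑[ v < n ] ([ does (u <? v) ∧ does (adjacent? G u v) ] * w (u , v))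
    ≡⟨ sum-cong-≗ {n} (λ u → sum-cong-≗ {n} (pointwise u)) ⟩
  ∑[ u < n ] ∑[ v < n ] ([ does (u <? v) ] * (adj G u v * h u v + adj G v u * h v u))
    ≡⟨ ∑-unordered (λ u v → adj G u v * h u v) (λ u → cong (_* h u u) (adj-diag G u)) ⟩
  ∑[ u < n ] ∑[ v < n ] (adj G u v * h u v)
    ∎
  where
  open ≡-Reasoning
  onEdges : ∀ u v → adj G u v * w (u , v) ≡ adj G u v * (h u v + h v u)
  onEdges u v with adjacent? G u v
  ... | yes u~v = cong (_+ 0) (w≡h+h u v u~v)
  ... | no _    = refl
  pointwise : ∀ u v → [ does (u <? v) ∧ does (adjacent? G u v) ] * w (u , v) ≡
                      [ does (u <? v) ] * (adj G u v * h u v + adj G v u * h v u)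
  pointwise u v = begin
    [ does (u <? v) ∧ does (adjacent? G u v) ] * w (u , v)
      ≡⟨ cong (_* w (u , v)) ([∧] (does (u <? v)) _) ⟩
    [ does (u <? v) ] * adj G u v * w (u , v)
      ≡⟨ *-assoc [ does (u <? v) ] (adj G u v) (w (u , v)) ⟩
    [ does (u <? v) ] * (adj G u v * w (u , v))
      ≡⟨ cong ([ does (u <? v) ] *_) (trans (onEdges u v) (*-distribˡ-+ (adj G u v) (h u v) (h v u))) ⟩
    [ does (u <? v) ] * (adj G u v * h u v + adj G u v * h v u)
      ≡⟨ cong (λ e → [ does (u <? v) ] * (adj G u v * h u v + e * h v u)) (adj-sym G u v) ⟩
    [ does (u <? v) ] * (adj G u v * h u v + adj G v u * h v u)
      ∎

2*total : (w : A → ℕ) (xs : List A) → 2 * total w xs ≡ total (λ x → w x + w x) xs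
2*total w []       = refl
2*total w (x ∷ xs) = trans (double (w x) (total w xs)) (cong (w x + w x +_) (2*total w xs))
  where
  double : ∀ a b → 2 * (a + b) ≡ a + a + 2 * b
  double = solve-∀

-- The factor 2 lets each edge give one full indicator to each of its ends; the two indicators agree
-- by the symmetry of the coloring.
∑colorDegree : (α : Coloring N) (c : Color) → 2 * classSize α c ≡ sum (colorDegree α c)
∑colorDegree {N} α c = begin
  2 * classSize α c
    ≡⟨ cong (2 *_) (length-filter (λ (u , v) → color α u v ≟ᶜ c) (edges (complete N))) ⟩
  2 * total (λ (u , v) → γ u v) (edges (complete N))
    ≡⟨ 2*total (λ (u , v) → γ u v) (edges (complete N)) ⟩
  total (λ (u , v) → γ u v + γ u v) (edges (complete N))
    ≡⟨ handshake (complete N) (λ (u , v) → γ u v + γ u v) γ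
         (λ u v _ → cong (λ d → γ u v + [ does (d ≟ᶜ c) ]) (color-sym α u v)) ⟩
  ∑[ u < N ] ∑[ v < N ] (adj (complete N) u v * γ u v)
    ≡⟨ sum-cong-≗ {N} (λ u → sum-cong-≗ {N} (λ v → [∧] (not (does (u ≟ v))) (does (color α u v ≟ᶜ c)))) ⟨
  ∑[ u < N ] ∑[ v < N ] [ joined α c u v ]
    ≡⟨ ∑-comm (λ u v → [ joined α c u v ]) ⟩
  sum (colorDegree α c)
    ∎
  where
  open ≡-Reasoning
  γ : Fin N → Fin N → ℕ
  γ u v = [ does (color α u v ≟ᶜ c) ]

-- The threshold on the color classes

2*nC2 : ∀ n → 2 * (suc n C 2) ≡ suc n * n
2*nC2 zero    = refl
2*nC2 (suc n) = begin
  2 * (suc (suc n) C 2)           ≡⟨ cong (2 *_) (nCk+nC[k+1]≡[n+1]C[k+1] (suc n) 1) ⟨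
  2 * (suc n C 1 + suc n C 2)     ≡⟨ *-distribˡ-+ 2 (suc n C 1) (suc n C 2) ⟩
  2 * (suc n C 1) + 2 * (suc n C 2) ≡⟨ cong₂ (λ a b → 2 * a + b) (nC1≡n (suc n)) (2*nC2 n) ⟩
  2 * suc n + suc n * n           ≡⟨ arith n ⟩
  suc (suc n) * suc n             ∎
  where
  open ≡-Reasoning
  arith : ∀ n → 2 * suc n + suc n * n ≡ suc (suc n) * suc n
  arith = solve-∀

-- The threshold m = N²/8 is about half of the allowed maximum N²/4.
threshold<half : ∀ n → 4 ≤ n → (n * n) / 8 < (n C 2) / 2
threshold<half (suc n) (s≤s 3≤n) = begin
  suc m                  ≡⟨ m*n/n≡m (suc m) 2 ⟨
  suc m * 2 / 2          ≤⟨ /-monoˡ-≤ 2 (*-cancelʳ-≤ (suc m * 2) (suc n C 2) 4 bound) ⟩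
  (suc n C 2) / 2        ∎
  where
  open ≤-Reasoning
  m : ℕ
  m = (suc n * suc n) / 8
  bound : suc m * 2 * 4 ≤ (suc n C 2) * 4
  bound = begin
    suc m * 2 * 4               ≡⟨ *-assoc (suc m) 2 4 ⟩
    8 + m * 8                   ≤⟨ +-monoʳ-≤ 8 (m/n*n≤m (suc n * suc n) 8) ⟩
    8 + suc n * suc n           ≡⟨ i₁ n ⟩
    n * n + 2 * n + 9           ≤⟨ +-monoʳ-≤ (n * n + 2 * n) (*-mono-≤ 3≤n 3≤n) ⟩
    n * n + 2 * n + n * n       ≡⟨ i₂ n ⟩
    2 * (suc n * n)             ≡⟨ cong (2 *_) (2*nC2 n) ⟨
    2 * (2 * (suc n C 2))       ≡⟨ i₃ (suc n C 2) ⟩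
    (suc n C 2) * 4             ∎
    where
    i₁ : ∀ n → 8 + suc n * suc n ≡ n * n + 2 * n + 9
    i₁ = solve-∀
    i₂ : ∀ n → n * n + 2 * n + n * n ≡ 2 * (suc n * n)
    i₂ = solve-∀
    i₃ : ∀ x → 2 * (2 * x) ≡ x * 4
    i₃ = solve-∀

-- Strictly exceeding the rounded-down quotient forces a class size of at least `N * N / 8`, and the
-- degrees in that color sum to twice the class size.
threshold⇒dense : (α : Coloring N) (c : Color) → classSize α c > (N * N) / 8 →
                  N * N ≤ 4 * sum (colorDegree α c)
threshold⇒dense {N} α c large = begin
  N * N                              ≡⟨ m≡m%n+[m/n]*n (N * N) 8 ⟩
  (N * N) % 8 + (N * N) / 8 * 8      ≤⟨ +-monoˡ-≤ ((N * N) / 8 * 8) (<⇒≤ (m%n<n (N * N) 8)) ⟩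
  suc ((N * N) / 8) * 8              ≤⟨ *-monoˡ-≤ 8 large ⟩
  classSize α c * 8                  ≡⟨ arith (classSize α c) ⟩
  4 * (2 * classSize α c)            ≡⟨ cong (4 *_) (∑colorDegree α c) ⟩
  4 * sum (colorDegree α c)          ∎
  where
  open ≤-Reasoning
  arith : ∀ x → x * 8 ≡ 4 * (2 * x)
  arith = solve-∀

-- Balanced copies of regular bipartite graphs

∑adj : (G : Graph n) (d : ℕ) → Regular d G → (w : Fin n → ℕ) →
       ∑[ u < n ] ∑[ v < n ] (adj G u v * w u) ≡ d * sum w
∑adj {n} G d regular w = begin
  ∑[ u < n ] ∑[ v < n ] (adj G u v * w u)
    ≡⟨ sum-cong-≗ {n} (λ u → *-distribʳ-sum (w u) (adj G u)) ⟨
  ∑[ u < n ] (sum (adj G u) * w u)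
    ≡⟨ sum-cong-≗ {n} (λ u → cong (_* w u) (trans (sym (degree≡∑ G u)) (regular u))) ⟩
  ∑[ u < n ] (d * w u)
    ≡⟨ *-distribˡ-sum d w ⟨
  d * sum w
    ∎
  where open ≡-Reasoning

isLeft : Side → Bool
isLeft left  = true
isLeft right = false

-- The edges are counted once by their left ends and once by their right ends; each edge has exactly
-- one of either kind, and the positive factor `d` cancels.
sidesEqual : (G : Graph n) (d : ℕ) .{{_ : NonZero d}} → Regular d G → (B : Bipartite G) →
             size (isLeft ∘ proj₁ B) ≡ size (not ∘ isLeft ∘ proj₁ B)
sidesEqual {n} G d regular (side , bipartite) = *-cancelˡ-≡ _ _ d (begin
  d * size L
    ≡⟨ ∑adj G d regular (λ u → [ L u ]) ⟨
  ∑[ u < n ] ∑[ v < n ] (adj G u v * [ L u ])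
    ≡⟨ sum-cong-≗ {n} (λ u → sum-cong-≗ {n} (flipSide u)) ⟩
  ∑[ u < n ] ∑[ v < n ] (adj G v u * [ not (L v) ])
    ≡⟨ ∑-comm (λ u v → adj G v u * [ not (L v) ]) ⟩
  ∑[ v < n ] ∑[ u < n ] (adj G v u * [ not (L v) ])
    ≡⟨ ∑adj G d regular (λ v → [ not (L v) ]) ⟩
  d * size (not ∘ L)
    ∎)
  where
  open ≡-Reasoning
  L : Fin n → Bool
  L = isLeft ∘ side
  opposite : ∀ s t → s ≢ t → [ isLeft s ] ≡ [ not (isLeft t) ]
  opposite left  left  s≢t = contradiction refl s≢t
  opposite left  right _   = refl
  opposite right left  _   = refl
  opposite right right s≢t = contradiction refl s≢t
  flipSide : ∀ u v → adj G u v * [ L u ] ≡ adj G v u * [ not (L v) ]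
  flipSide u v rewrite adj-sym G v u with adjacent? G u v
  ... | yes u~v = cong (_+ 0) (opposite (side u) (side v) (bipartite u v u~v))
  ... | no _    = refl

size-not : (S : Fin n → Bool) → size S + size (not ∘ S) ≡ n
size-not {n} S = begin
  size S + size (not ∘ S)                  ≡⟨ ∑-distrib-+ (λ i → [ S i ]) (λ i → [ not (S i) ]) ⟨
  ∑[ i < n ] ([ S i ] + [ not (S i) ])     ≡⟨ sum-cong-≗ {n} (λ i → one (S i)) ⟩
  ∑[ i < n ] 1                             ≡⟨ sum-const n 1 ⟩
  n * 1                                    ≡⟨ *-identityʳ n ⟩
  n                                        ∎
  where
  open ≡-Reasoning
  one : ∀ b → [ b ] + [ not b ] ≡ 1
  one true  = refl
  one false = refl

-- The role `nothing` sends a vertex to the hub, `just c` to the vertices joined to it in color c.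
Role : Set
Role = Maybe Color

has : Color → Role → ℕ
has c nothing   = 0
has c (just c′) = [ does (c′ ≟ᶜ c) ]

data Opposed : Role → Role → Set where
  hub-color : ∀ c → Opposed nothing (just c)
  color-hub : ∀ c → Opposed (just c) nothing

-- Every edge of `G` runs between the hub and a vertex with a color as its role, and its image takes
-- that color. So color `c` occurs `d` times for each vertex of role `just c`, and equally many red
-- and blue roles give equally many red and blue edges.
containsBalancedCopy : (G : Graph n) (d : ℕ) → Regular d G → (role : Fin n → Role) →
  (∀ u v → Adjacent G u v → Opposed (role u) (role v)) →
  sum (has red ∘ role) ≡ sum (has blue ∘ role) →
  (α : Coloring N) → HubPattern α n → ContainsBalancedCopy α G
containsBalancedCopy {n} {N} G d regular role opposed red≡blue α (f , g , f-inj , g-inj , f~g) =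
  K , ≤-trans (≤-reflexive (m≡n⇒∣m-n∣≡0 counts≡)) z≤n
  where
  open ≡-Reasoning
  -- Each vertex keeps its own index within the part of the pattern that its role selects, so
  -- nothing has to be renumbered.
  place : Role → Fin n → Fin N
  place nothing  = f
  place (just c) = g c

  g~f : ∀ c i j → color α (g c i) (f j) ≡ c
  g~f c i j = joined⇒color α c (g c i) (f j) (f~g c i j)

  g≢f : ∀ c i j → g c i ≢ f j
  g≢f c i j = joined⇒≢ α c (g c i) (f j) (f~g c i j)

  place-inj : ∀ r s {u v} → place r u ≡ place s v → u ≡ v
  place-inj nothing  nothing  eq = f-inj eq
  place-inj nothing  (just c) eq = contradiction (sym eq) (g≢f c _ _)
  place-inj (just c) nothing  eq = contradiction eq (g≢f c _ _)
  -- A common point of `g c` and `g c′` would be joined to the hub vertex `f u` in both `c` and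
  -- `c′`, so the two colors agree.
  place-inj (just c) (just c′) {u} {v} eq
    with trans (sym (g~f c u u)) (trans (cong (λ x → color α x (f u)) eq) (g~f c′ v u))
  ... | refl = g-inj c eq

  e : Fin n → Fin N
  e v = place (role v) v

  K : Copy G (complete N)
  K = record
    { embed     = e
    ; injective = λ {u} {v} → place-inj (role u) (role v)
    ; preserves = λ u v u~v eu≡ev → loopless G (place-inj (role u) (role v) eu≡ev) u~v
    }

  -- The sum has the shape that `handshake` asks for: the hub end contributes 0, so the share of the
  -- colored end is the whole indicator.
  colorOf : ∀ c r s u v → Opposed r s →
            [ does (color α (place r u) (place s v) ≟ᶜ c) ] ≡ has c r + has c s
  colorOf c _ _ u v (hub-color c′) =
    cong (λ x → [ does (x ≟ᶜ c) ]) (trans (color-sym α (f u) (g c′ v)) (g~f c′ v u))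
  colorOf c _ _ u v (color-hub c′) =
    trans (cong (λ x → [ does (x ≟ᶜ c) ]) (g~f c′ u v)) (sym (+-identityʳ _))

  counts : ∀ c → count α c (copyEdges K) ≡ d * sum (has c ∘ role)
  counts c = begin
    count α c (copyEdges K)
      ≡⟨ length-filter (λ (u , v) → color α u v ≟ᶜ c) (copyEdges K) ⟩
    total (λ (u , v) → [ does (color α u v ≟ᶜ c) ]) (copyEdges K)
      ≡⟨ total-map (Product.map e e) (λ (u , v) → [ does (color α u v ≟ᶜ c) ]) (edges G) ⟩
    total (λ (u , v) → [ does (color α (e u) (e v) ≟ᶜ c) ]) (edges G)
      ≡⟨ handshake G (λ (u , v) → [ does (color α (e u) (e v) ≟ᶜ c) ]) (λ u _ → has c (role u))
           (λ u v u~v → colorOf c (role u) (role v) u v (opposed u v u~v)) ⟩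
    ∑[ u < n ] ∑[ v < n ] (adj G u v * has c (role u))
      ≡⟨ ∑adj G d regular (has c ∘ role) ⟩
    d * sum (has c ∘ role)
      ∎

  counts≡ : count α red (copyEdges K) ≡ count α blue (copyEdges K)
  counts≡ = trans (counts red) (trans (cong (d *_) red≡blue) (sym (counts blue)))

-- The right side becomes the hub. The sides have equal size, so the left one has `2 * n` vertices;
-- divisibility of the order by 4 is what allows it to be halved into red and blue roles.
balancedRoles : (d n : ℕ) .{{_ : NonZero d}} (G : Graph (4 * n)) → Bipartite G → Regular d G →
  Σ[ role ∈ (Fin (4 * n) → Role) ]
    (∀ u v → Adjacent G u v → Opposed (role u) (role v)) ×
    sum (has red ∘ role) ≡ sum (has blue ∘ role)
balancedRoles d n G B@(side , bipartite) regular =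
  role , (λ u v u~v → opposed (side u) (side v) (T u) (T v) (bipartite u v u~v)) ,
  trans reds (sym (+-cancelʳ-≡ n _ n (trans blues ∣L∣≡2n)))
  where
  open ≡-Reasoning
  L : Fin (4 * n) → Bool
  L = isLeft ∘ side

  ∣L∣≡2n : size L ≡ n + n
  ∣L∣≡2n = *-cancelˡ-≡ (size L) (n + n) 2 (begin
    2 * size L                 ≡⟨ cong (size L +_) (+-identityʳ (size L)) ⟩
    size L + size L            ≡⟨ cong (size L +_) (sidesEqual G d regular B) ⟩
    size L + size (not ∘ L)    ≡⟨ size-not L ⟩
    4 * n                      ≡⟨ arith n ⟩
    2 * (n + n)                ∎)
    where
    arith : ∀ n → 4 * n ≡ 2 * (n + n)
    arith = solve-∀

  half : ∃[ T ] (∀ i → T i ≡ true → L i ≡ true) × size T ≡ n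
  half = subset L n (≤-trans (m≤m+n n n) (≤-reflexive (sym ∣L∣≡2n)))

  T : Fin (4 * n) → Bool
  T = proj₁ half

  roleOf : Side → Bool → Role
  roleOf left  true  = just red
  roleOf left  false = just blue
  roleOf right _     = nothing

  role : Fin (4 * n) → Role
  role u = roleOf (side u) (T u)

  opposed : ∀ s t a b → s ≢ t → Opposed (roleOf s a) (roleOf t b)
  opposed left  left  _     _     s≢t = contradiction refl s≢t
  opposed left  right true  _     _   = color-hub red
  opposed left  right false _     _   = color-hub blue
  opposed right left  _     true  _   = hub-color red
  opposed right left  _     false _   = hub-color blue
  opposed right right _     _     s≢t = contradiction refl s≢t

  reds : sum (has red ∘ role) ≡ n
  reds = trans (sum-cong-≗ {4 * n} λ u → pointwise (side u) (T u) (proj₁ (proj₂ half) u))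
               (proj₂ (proj₂ half))
    where
    pointwise : ∀ s t → (t ≡ true → isLeft s ≡ true) → has red (roleOf s t) ≡ [ t ]
    pointwise left  true  _ = refl
    pointwise left  false _ = refl
    pointwise right true  t⇒s = contradiction (t⇒s refl) λ ()
    pointwise right false _ = refl

  -- The blue roles are counted as the complement of the red ones within the left side.
  blues : sum (has blue ∘ role) + n ≡ size L
  blues = begin
    sum (has blue ∘ role) + n
      ≡⟨ cong (sum (has blue ∘ role) +_) reds ⟨
    sum (has blue ∘ role) + sum (has red ∘ role)
      ≡⟨ ∑-distrib-+ (has blue ∘ role) (has red ∘ role) ⟨
    ∑[ u < 4 * n ] (has blue (role u) + has red (role u))
      ≡⟨ sum-cong-≗ {4 * n} (λ u → pointwise (side u) (T u)) ⟩
    size L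
      ∎
    where
    pointwise : ∀ s t → has blue (roleOf s t) + has red (roleOf s t) ≡ [ isLeft s ]
    pointwise left  true  = refl
    pointwise left  false = refl
    pointwise right _     = refl

proposition10 : (d : ℕ) → d ≥ 1 → (n : ℕ) → n ≥ 1 →
    (G : Graph (4 * n)) → Bipartite G → Regular d G → Balanceable G
proposition10 d d≥1 n n≥1 G bipartite regular =
  -- A sum, so that each summand is itself a lower bound for `N`: 64 absorbs the diagonal pairs in
  -- `manyMixed`, `256 * t` leaves room for fresh vertices in the greedy choice, and the last
  -- summand leaves `t` hub vertices after a loss of 64 for mixedness and of `256 ^ t` per color.
  64 + (256 * t + 64 * (256 ^ t * 256 ^ t) * t) , λ N N≥N₀ →
    let 64≤N   = m+n≤o⇒m≤o 64 N≥N₀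
        rest≤N = m+n≤o⇒n≤o 64 N≥N₀
    in (N * N) / 8 , threshold<half N (≤-trans (m≤m+n 4 60) 64≤N) , λ α manyRed manyBlue →
      containsBalancedCopy G d regular role opposed red≡blue α
        (hubPattern t α 64≤N (m+n≤o⇒m≤o (256 * t) rest≤N) (m+n≤o⇒n≤o (256 * t) rest≤N)
          λ { red → threshold⇒dense α red manyRed ; blue → threshold⇒dense α blue manyBlue })
  where
  t : ℕ
  t = 4 * n
  roles = balancedRoles d n {{>-nonZero d≥1}} G bipartite regular
  role = proj₁ roles
  opposed = proj₁ (proj₂ roles)
  red≡blue = proj₂ (proj₂ roles)
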